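{- Let $m,n\ge 1$. (I) Let $R=(r_1,\dots,r_m)$ and $S=(s_1,\dots,s_n)$ be vectors of nonnegative real numbers with $\sum_i r_i=\sum_j s_j$. Then $\mathcal{T}^{0}(R,S)\neq\emptyset$ if and only if (a) $R$ is palindromic, i.e. $r_i=r_{m+1-i}$ for all $i$. (II) Suppose in addition that $R$ and $S$ have nonnegative integer components. Then $\mathcal{T}^{0}_{\mathbb{Z}}(R,S)\neq\emptyset$ if and only if (a) holds and (b) if $m$ is even then every component of $S$ is even, and if $m$ is odd then $r_{\lceil m/2\rceil}\ge o(S)$, where $o(S)$ is the number of odd components of $S$.
   Context: $\mathcal{T}(R,S)$ is the set of $m\times n$ matrices with nonnegative real entries whose $i$th row sum is $r_i$ and whose $j$th column sum is $s_j$ for all $i,j$. The reflection $r_0$ (in a horizontal line) acts on $m\times n$ matrices by $(r_0 A)_{i,j}=a_{m+1-i,\,j}$. $\mathcal{T}^{0}(R,S)$ is the set of $A\in\mathcal{T}(R,S)$ with $r_0 A=A$; $\mathcal{T}^{0}_{\mathbb{Z}}(R,S)$ is the set of those $A\in\mathcal{T}^{0}(R,S)$ all of whose entries are integers. -}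

module Defs where

open import Algebra.Bundles.Raw using (RawMonoid)
import Algebra.Definitions.RawMonoid as RawMonoidDefinitions
open import Data.Fin.Base using (Fin; fromℕ<; opposite)
open import Data.Integer.Base as ℤ using (ℤ; +_)
open import Data.List.Base as List using (filter)
open import Data.Nat.Base as ℕ using (ℕ; suc; pred; NonZero; ⌈_/2⌉; s≤s)
open import Data.Nat.Divisibility using (_∣_; _∣?_)
import Data.Nat.Properties as ℕ
open import Data.Product.Base using (∃; _×_; _,_)
open import Data.Rational.Base as ℚ using (ℚ; 0ℚ; ½; ∣_∣)
import Data.Rational.Properties as ℚ
open import Data.Rational.Solver using (module +-*-Solver)
open import Data.Vec.Functional using (Vector; toList)
open import Level using (0ℓ)
open import Relation.Binary.PropositionalEquality using (_≡_; refl; cong; subst; subst₂; sym)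
open import Relation.Nullary.Negation using (¬_)
open import Relation.Nullary.Decidable using (¬?)

open +-*-Solver using (solve; con; _:+_; _:-_; _:*_; _:=_)

-- Real numbers: Cauchy sequences of rationals, up to the setoid
-- equality _≈_ ("the difference tends to 0").

IsCauchy : (ℕ → ℚ) → Set
IsCauchy x = ∀ ε → 0ℚ ℚ.< ε →
  ∃ λ N → ∀ i j → N ℕ.≤ i → N ℕ.≤ j → ∣ x i ℚ.- x j ∣ ℚ.< ε

record ℝ : Set where
  constructor mkℝ
  field
    seq    : ℕ → ℚ
    cauchy : IsCauchy seq

open ℝ public

infix 4 _≈_ _≤_
infixl 6 _+_

record _≈_ (x y : ℝ) : Set where
  constructor mk≈
  field
    close : ∀ ε → 0ℚ ℚ.< ε →
      ∃ λ N → ∀ i → N ℕ.≤ i → ∣ seq x i ℚ.- seq y i ∣ ℚ.< ε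

-- The slack ε makes the order independent of the chosen
-- representatives: termwise comparison of sequences would not be.
record _≤_ (x y : ℝ) : Set where
  constructor mk≤
  field
    below : ∀ ε → 0ℚ ℚ.< ε →
      ∃ λ N → ∀ i → N ℕ.≤ i → seq x i ℚ.< seq y i ℚ.+ ε

private abstract
  const-cauchy : ∀ q → IsCauchy (λ _ → q)
  const-cauchy q ε 0<ε = 0 , λ _ _ _ _ →
    subst (λ d → ∣ d ∣ ℚ.< ε) (sym (ℚ.+-inverseʳ q)) 0<ε

fromℚ : ℚ → ℝ
fromℚ q = mkℝ (λ _ → q) (const-cauchy q)

fromℤ : ℤ → ℝ
fromℤ z = fromℚ (z ℚ./ 1)

fromℕ : ℕ → ℝ
fromℕ k = fromℤ (+ k)

0ℝ : ℝ
0ℝ = fromℚ 0ℚ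

private abstract
  interchange : ∀ a b c d → (a ℚ.- c) ℚ.+ (b ℚ.- d) ≡ (a ℚ.+ b) ℚ.- (c ℚ.+ d)
  interchange = solve 4 (λ a b c d →
    (a :- c) :+ (b :- d) := (a :+ b) :- (c :+ d)) refl

  halves : ∀ ε → ½ ℚ.* ε ℚ.+ ½ ℚ.* ε ≡ ε
  halves = solve 1 (λ ε → con ½ :* ε :+ con ½ :* ε := ε) refl

  0<½* : ∀ ε → 0ℚ ℚ.< ε → 0ℚ ℚ.< ½ ℚ.* ε
  0<½* ε 0<ε = subst (ℚ._< ½ ℚ.* ε) (ℚ.*-zeroʳ ½) (ℚ.*-monoʳ-<-pos ½ 0<ε)

  +-cauchy : ∀ x y → IsCauchy x → IsCauchy y → IsCauchy (λ i → x i ℚ.+ y i)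
  +-cauchy x y cx cy ε 0<ε =
    let M , close-x = cx (½ ℚ.* ε) (0<½* ε 0<ε)
        N , close-y = cy (½ ℚ.* ε) (0<½* ε 0<ε)
    in M ℕ.⊔ N , λ i j ≤i ≤j →
      subst₂ ℚ._<_ (cong ∣_∣ (interchange (x i) (y i) (x j) (y j))) (halves ε)
        (ℚ.≤-<-trans (ℚ.∣p+q∣≤∣p∣+∣q∣ (x i ℚ.- x j) (y i ℚ.- y j))
          (ℚ.+-mono-<
            (close-x i j (ℕ.m⊔n≤o⇒m≤o M N ≤i) (ℕ.m⊔n≤o⇒m≤o M N ≤j))
            (close-y i j (ℕ.m⊔n≤o⇒n≤o M N ≤i) (ℕ.m⊔n≤o⇒n≤o M N ≤j))))

_+_ : ℝ → ℝ → ℝ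
x + y = mkℝ (λ i → seq x i ℚ.+ seq y i) (+-cauchy (seq x) (seq y) (cauchy x) (cauchy y))

+-0-rawMonoid : RawMonoid 0ℓ 0ℓ
+-0-rawMonoid = record { Carrier = ℝ ; _≈_ = _≈_ ; _∙_ = _+_ ; ε = 0ℝ }

open RawMonoidDefinitions +-0-rawMonoid public using (sum)

IsInteger : ℝ → Set
IsInteger x = ∃ λ z → x ≈ fromℤ z

Matrix : ℕ → ℕ → Set
Matrix m n = Fin m → Fin n → ℝ

Nonneg : ∀ {n} → Vector ℝ n → Set
Nonneg v = ∀ i → 0ℝ ≤ v i

record 𝒯 {m n} (R : Vector ℝ m) (S : Vector ℝ n) (A : Matrix m n) : Set where
  field
    nonneg  : ∀ i j → 0ℝ ≤ A i j
    row-sum : ∀ i → sum (λ j → A i j) ≈ R i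
    col-sum : ∀ j → sum (λ i → A i j) ≈ S j

-- opposite sends the 1-based index i to m + 1 - i.
r₀ : ∀ {m n} → Matrix m n → Matrix m n
r₀ A i j = A (opposite i) j

𝒯⁰ : ∀ {m n} → Vector ℝ m → Vector ℝ n → Matrix m n → Set
𝒯⁰ R S A = 𝒯 R S A × (∀ i j → r₀ A i j ≈ A i j)

𝒯⁰ℤ : ∀ {m n} → Vector ℝ m → Vector ℝ n → Matrix m n → Set
𝒯⁰ℤ R S A = 𝒯⁰ R S A × (∀ i j → IsInteger (A i j))

NonEmpty : ∀ {m n} → (Matrix m n → Set) → Set
NonEmpty X = ∃ λ A → X A

Palindromic : ∀ {m} → Vector ℝ m → Set
Palindromic R = ∀ i → R i ≈ R (opposite i)

Even Odd : ℕ → Set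
Even k = 2 ∣ k
Odd k = ¬ Even k

#odd : ∀ {n} → Vector ℕ n → ℕ
#odd S = List.length (filter (λ s → ¬? (2 ∣? s)) (toList S))

private
  pred⌈m/2⌉<m : ∀ m → .{{NonZero m}} → pred ⌈ m /2⌉ ℕ.< m
  pred⌈m/2⌉<m (suc k) = s≤s (ℕ.⌊n/2⌋≤n k)

-- The 1-based index ⌈ m /2⌉; Fin counts from 0.
middle : ∀ m → .{{NonZero m}} → Fin m
middle m = fromℕ< (pred⌈m/2⌉<m m)

ParityCondition : ∀ {m n} → .{{NonZero m}} → Vector ℕ m → Vector ℕ n → Set
ParityCondition {m} R S =
  (Even m → ∀ j → Even (S j)) × (Odd m → #odd S ℕ.≤ R (middle m))

{-# OPTIONS --safe #-}
module Submission where

open import Defs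
open import Algebra.Bundles using (CommutativeMonoid)
import Algebra.Properties.CommutativeMonoid.Sum as CommutativeMonoidSum
open import Data.Bool.Base using (if_then_else_)
open import Data.Fin.Base using (Fin; zero; suc; toℕ; opposite; punchIn)
import Data.Fin.Permutation as Perm
import Data.Fin.Properties as Fin
open import Data.Integer.Base as ℤ using (+_; -[1+_])
import Data.Integer.Properties as ℤ
import Data.List.Base as List
open import Data.List.Properties using (filter-accept; filter-reject)
open import Data.Nat.Base as ℕ using (ℕ; NonZero; zero; suc; _/_; _%_)
open import Data.Nat.Divisibility using (_∣?_; divides-refl; n∣m⇒m%n≡0; m%n≡0⇒n∣m)
open import Data.Nat.DivMod using (m%n<n; m%n≤m; m≡m%n+[m/n]*n; [m+kn]%n≡m%n; m*n/n≡m)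
import Data.Nat.Properties as ℕ
open import Data.Nat.Tactic.RingSolver using (solve-∀)
open import Data.Product.Base using (∃; Σ; _×_; _,_; proj₁; proj₂)
open import Data.Rational.Base as ℚ using (ℚ; 0ℚ; ½; ∣_∣)
import Data.Rational.Properties as ℚ
open import Data.Rational.Solver using (module +-*-Solver)
import Data.Rational.Unnormalised.Base as ℚᵘ
import Data.Rational.Unnormalised.Properties as ℚᵘ
open import Data.Sum.Base using (inj₁; inj₂)
open import Data.Vec.Functional using (Vector; _∷_; tail; removeAt)
open import Function.Base using (_∘_)
open import Function.Bundles using (_⇔_; mk⇔)
open import Level using (_⊔_)
open import Relation.Binary.Definitions using (tri<; tri≈; tri>)
open import Relation.Binary.PropositionalEquality
  using (_≡_; _≢_; _≗_; refl; cong; cong₂; subst; subst₂; sym; trans; module ≡-Reasoning)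
open import Relation.Nullary.Decidable using (Dec; yes; no; does; ¬?; decidable-stable)
open import Relation.Nullary.Negation using (¬_; contradiction)

open +-*-Solver using (solve; con; _:+_; _:-_; _:*_; :-_; _:=_)

-- The real matrix is the average of B and r₀ B, where B is produced by the
-- northwest-corner rule. Neither a case distinction r₁ ≤ s₁ nor a division by
-- the total sum is available constructively; the rule is therefore run through
-- the Riesz refinement property of ℝ≥0, whose witnesses are continuous in the data.
--
-- For integers, r₀ pairs up equal entries of a column except in the middle row,
-- which forces the parity condition. Conversely, put σⱼ mod 2 into the middle row; what
-- remains has even column sums and an even middle row sum, so it can be taken to
-- be B + r₀ B with B again given by the northwest-corner rule.

-- Riesz refinement (the two-by-two case) and the northwest-corner rule in a commutative monoid.

HasRefinement : ∀ {c ℓ} → CommutativeMonoid c ℓ → Set (c ⊔ ℓ)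
HasRefinement M = ∀ a b c d → (a ⊕ b) ≋ (c ⊕ d) →
  ∃ λ x → ∃ λ y → ∃ λ z → ∃ λ w →
    (x ⊕ y) ≋ a × (z ⊕ w) ≋ b × (x ⊕ z) ≋ c × (y ⊕ w) ≋ d
  where open CommutativeMonoid M renaming (_∙_ to _⊕_; _≈_ to _≋_)

module Transport {c ℓ} (M : CommutativeMonoid c ℓ) (refine : HasRefinement M) where

  open CommutativeMonoid M using (Carrier; identityʳ; ∙-congˡ)
    renaming (_∙_ to infixl 6 _⊕_; _≈_ to infix 4 _≋_; sym to ≋-sym; trans to ≋-trans)
  open CommutativeMonoidSum M using () renaming (sum to ∑)

  -- Columns are served one at a time: `refine` divides the first column sum into `x`, charged to
  -- `a`, and `z`, charged to `b`. What is still owed, `y` and `w`, is exactly what the remaining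
  -- columns hold.
  split : ∀ {n} a b (S : Vector Carrier (suc n)) → (a ⊕ b) ≋ ∑ S →
    ∃ λ U → ∃ λ V → ∑ U ≋ a × ∑ V ≋ b × (∀ j → (U j ⊕ V j) ≋ S j)
  split {zero} a b S eq =
    (λ _ → a) , (λ _ → b) , identityʳ a , identityʳ b ,
    λ { zero → ≋-trans eq (identityʳ (S zero)) }
  split {suc n} a b S eq =
    let x , y , z , w , xy , zw , xz , yw = refine a b (S zero) (∑ (tail S)) eq
        U , V , ∑U , ∑V , UV = split y w (tail S) yw
    in x ∷ U , z ∷ V ,
       ≋-trans (∙-congˡ ∑U) xy ,
       ≋-trans (∙-congˡ ∑V) zw ,
       λ { zero → xz ; (suc j) → UV j }

  -- Induction on the rows: `split` cuts the first row `U` out of the column sums and leaves `V` as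
  -- column sums for the other rows. Both sizes are positive because in a general monoid an empty
  -- sum on one side would not make the single summands on the other vanish.
  transport : ∀ {m n} .{{_ : NonZero m}} .{{_ : NonZero n}}
    (R : Vector Carrier m) (S : Vector Carrier n) → ∑ R ≋ ∑ S →
    ∃ λ (A : Fin m → Fin n → Carrier) →
      (∀ i → ∑ (A i) ≋ R i) × (∀ j → ∑ (λ i → A i j) ≋ S j)
  transport {suc m} {suc n} = go m
    where
    go : ∀ m (R : Vector Carrier (suc m)) (S : Vector Carrier (suc n)) → ∑ R ≋ ∑ S →
      ∃ λ (A : Fin (suc m) → Fin (suc n) → Carrier) →
        (∀ i → ∑ (A i) ≋ R i) × (∀ j → ∑ (λ i → A i j) ≋ S j)
    go zero R S eq =
      (λ _ → S) ,
      (λ { zero → ≋-trans (≋-sym eq) (identityʳ (R zero)) }) ,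
      λ j → identityʳ (S j)
    go (suc m) R S eq =
      let U , V , ∑U , ∑V , UV = split (R zero) (∑ (tail R)) S eq
          A , rows , cols = go m (tail R) V (≋-sym ∑V)
      in U ∷ A ,
         (λ { zero → ∑U ; (suc i) → rows i }) ,
         λ j → ≋-trans (∙-congˡ (cols j)) (UV j)

-- Refinement and finite sums of natural numbers.

module ∑ℕ = CommutativeMonoidSum ℕ.+-0-commutativeMonoid
open ∑ℕ using () renaming (sum to ∑)

-- The corner takes as much as it can, `a ⊓ c`. Since `a + b ≡ c + d`, the excess of `a` over `c`
-- equals that of `d` over `b`, and likewise with the roles exchanged; this settles the sums for `b`
-- and `d`.
ℕ-refine : HasRefinement ℕ.+-0-commutativeMonoid
ℕ-refine a b c d eq =
  a ℕ.⊓ c , a ℕ.∸ c , c ℕ.∸ a , b ℕ.⊓ d ,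
  meet+diff a c ,
  trans (ℕ.+-comm (c ℕ.∸ a) (b ℕ.⊓ d))
    (trans (cong (b ℕ.⊓ d ℕ.+_) c∸a≡b∸d) (meet+diff b d)) ,
  ℕ.m⊓n+n∸m≡n a c ,
  trans (ℕ.+-comm (a ℕ.∸ c) (b ℕ.⊓ d))
    (trans (cong (b ℕ.⊓ d ℕ.+_) a∸c≡d∸b) (ℕ.m⊓n+n∸m≡n b d))
  where
  meet+diff : ∀ p q → p ℕ.⊓ q ℕ.+ (p ℕ.∸ q) ≡ p
  meet+diff p q = trans (cong (ℕ._+ (p ℕ.∸ q)) (ℕ.⊓-comm p q)) (ℕ.m⊓n+n∸m≡n q p)

  c∸a≡b∸d : c ℕ.∸ a ≡ b ℕ.∸ d
  c∸a≡b∸d = begin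
    c ℕ.∸ a                     ≡⟨ ℕ.[m+n]∸[m+o]≡n∸o d c a ⟨
    (d ℕ.+ c) ℕ.∸ (d ℕ.+ a)     ≡⟨ cong₂ ℕ._∸_ (trans (ℕ.+-comm d c) (sym eq)) (ℕ.+-comm d a) ⟩
    (a ℕ.+ b) ℕ.∸ (a ℕ.+ d)     ≡⟨ ℕ.[m+n]∸[m+o]≡n∸o a b d ⟩
    b ℕ.∸ d                     ∎
    where open ≡-Reasoning

  a∸c≡d∸b : a ℕ.∸ c ≡ d ℕ.∸ b
  a∸c≡d∸b = begin
    a ℕ.∸ c                     ≡⟨ ℕ.[m+n]∸[m+o]≡n∸o b a c ⟨
    (b ℕ.+ a) ℕ.∸ (b ℕ.+ c)     ≡⟨ cong₂ ℕ._∸_ (trans (ℕ.+-comm b a) eq) (ℕ.+-comm b c) ⟩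
    (c ℕ.+ d) ℕ.∸ (c ℕ.+ b)     ≡⟨ ℕ.[m+n]∸[m+o]≡n∸o c d b ⟩
    d ℕ.∸ b                     ∎
    where open ≡-Reasoning

∑-mono-≤ : ∀ {n} {f g : Vector ℕ n} → (∀ i → f i ℕ.≤ g i) → ∑ f ℕ.≤ ∑ g
∑-mono-≤ {zero}  f≤g = ℕ.z≤n
∑-mono-≤ {suc n} f≤g = ℕ.+-mono-≤ (f≤g zero) (∑-mono-≤ (f≤g ∘ suc))

∑-zero : ∀ {n} {f : Vector ℕ n} → (∀ i → f i ≡ 0) → ∑ f ≡ 0
∑-zero {n} f≡0 = trans (∑ℕ.sum-cong-≗ f≡0) (∑ℕ.sum-replicate-zero n)

∑-supported-at : ∀ {n} (f : Vector ℕ n) k → (∀ i → i ≢ k → f i ≡ 0) → ∑ f ≡ f k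
∑-supported-at {suc n} f k f≡0 = begin
  ∑ f                       ≡⟨ ∑ℕ.sum-remove f ⟩
  f k ℕ.+ ∑ (removeAt f k)  ≡⟨ cong (f k ℕ.+_) (∑-zero (λ i → f≡0 (punchIn k i) (Fin.punchInᵢ≢i k i))) ⟩
  f k ℕ.+ 0                 ≡⟨ ℕ.+-identityʳ (f k) ⟩
  f k                       ∎
  where open ≡-Reasoning

-- Parity and the number of odd components.

even⇒%2≡0 : ∀ {k} → Even k → k % 2 ≡ 0
even⇒%2≡0 {k} = n∣m⇒m%n≡0 k 2

odd⇒%2≡1 : ∀ {k} → Odd k → k % 2 ≡ 1
odd⇒%2≡1 {k} odd with k % 2 in eq | m%n<n k 2
... | 0           | _                        = contradiction (m%n≡0⇒n∣m k 2 eq) odd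
... | 1           | _                        = refl
... | suc (suc _) | ℕ.s≤s (ℕ.s≤s ())

-- The remainder modulo 2 is the indicator of oddness. As a sum, the count can be compared column by
-- column with a row sum.
#odd≡∑%2 : ∀ {n} (S : Vector ℕ n) → #odd S ≡ ∑ (λ j → S j % 2)
#odd≡∑%2 {zero}  S = refl
#odd≡∑%2 {suc n} S = trans (count-head (2 ∣? S zero)) (cong (S zero % 2 ℕ.+_) (#odd≡∑%2 (tail S)))
  where
  count-head : Dec (Even (S zero)) → #odd S ≡ S zero % 2 ℕ.+ #odd (tail S)
  count-head (yes even) = trans
    (cong List.length (filter-reject (λ s → ¬? (2 ∣? s)) (contradiction even)))
    (cong (ℕ._+ #odd (tail S)) (sym (even⇒%2≡0 even)))
  count-head (no odd) = trans
    (cong List.length (filter-accept (λ s → ¬? (2 ∣? s)) odd))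
    (cong (ℕ._+ #odd (tail S)) (sym (odd⇒%2≡1 odd)))

-- Fixed points of the reflection of row indices.

toℕ-opposite : ∀ {m} (i : Fin m) → toℕ i ℕ.+ suc (toℕ (opposite i)) ≡ m
toℕ-opposite {m} i = begin
  toℕ i ℕ.+ suc (toℕ (opposite i))      ≡⟨ ℕ.+-suc (toℕ i) (toℕ (opposite i)) ⟩
  suc (toℕ i) ℕ.+ toℕ (opposite i)      ≡⟨ cong (suc (toℕ i) ℕ.+_) (Fin.opposite-prop i) ⟩
  suc (toℕ i) ℕ.+ (m ℕ.∸ suc (toℕ i))   ≡⟨ ℕ.m+[n∸m]≡n (Fin.toℕ<n i) ⟩
  m                                     ∎
  where open ≡-Reasoning

-- Once `m` is `suc (k + k)`, the index `pred ⌈ m /2⌉` computes to `⌊ k + k /2⌋`.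
toℕ-middle : ∀ {m} .{{_ : NonZero m}} k → m ≡ suc (k ℕ.+ k) → toℕ (middle m) ≡ k
toℕ-middle k refl = trans (Fin.toℕ-fromℕ< _) (sym (ℕ.n≡⌊n+n/2⌋ k))

-- A fixed row has equally many rows above and below it. Hence `m` is odd, and the position of the
-- row is determined by `m`.
fixed⇒size : ∀ {m} {i : Fin m} → i ≡ opposite i → m ≡ suc (toℕ i ℕ.+ toℕ i)
fixed⇒size {m} {i} fixed = begin
  m                                  ≡⟨ toℕ-opposite i ⟨
  toℕ i ℕ.+ suc (toℕ (opposite i))   ≡⟨ cong (λ k → toℕ i ℕ.+ suc (toℕ k)) fixed ⟨
  toℕ i ℕ.+ suc (toℕ i)              ≡⟨ ℕ.+-suc (toℕ i) (toℕ i) ⟩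
  suc (toℕ i ℕ.+ toℕ i)              ∎
  where open ≡-Reasoning

k+k≡k*2 : ∀ k → k ℕ.+ k ≡ k ℕ.* 2
k+k≡k*2 = solve-∀

fixed⇒odd : ∀ {m} {i : Fin m} → i ≡ opposite i → Odd m
fixed⇒odd {m} {i} fixed even = contradiction (trans (sym %2≡1) (even⇒%2≡0 even)) λ ()
  where
  %2≡1 : m % 2 ≡ 1
  %2≡1 = trans (cong (_% 2) (trans (fixed⇒size fixed) (cong suc (k+k≡k*2 (toℕ i)))))
    ([m+kn]%n≡m%n 1 (toℕ i) 2)

fixed⇒middle : ∀ {m} .{{_ : NonZero m}} {i : Fin m} → i ≡ opposite i → i ≡ middle m
fixed⇒middle {i = i} fixed = Fin.toℕ-injective (sym (toℕ-middle (toℕ i) (fixed⇒size fixed)))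

middle-fixed : ∀ {m} .{{_ : NonZero m}} → Odd m → middle m ≡ opposite (middle m)
middle-fixed {m} odd = Fin.toℕ-injective (begin
  toℕ (middle m)                  ≡⟨ toℕ-middle k m≡ ⟩
  k                               ≡⟨ ℕ.m+n∸m≡n (suc k) k ⟨
  suc (k ℕ.+ k) ℕ.∸ suc k         ≡⟨ cong₂ (λ a b → a ℕ.∸ suc b) m≡ (toℕ-middle k m≡) ⟨
  m ℕ.∸ suc (toℕ (middle m))      ≡⟨ Fin.opposite-prop (middle m) ⟨
  toℕ (opposite (middle m))       ∎)
  where
  open ≡-Reasoning
  k : ℕ
  k = m / 2
  m≡ : m ≡ suc (k ℕ.+ k)
  m≡ = trans (m≡m%n+[m/n]*n m 2) (cong₂ ℕ._+_ (odd⇒%2≡1 odd) (sym (k+k≡k*2 k)))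

-- Splitting a symmetric vector into mirror pairs and a centre.

infix 7 _when_

_when_ : ∀ {P : Set} → ℕ → Dec P → ℕ
x when d = if does d then x else 0

when-yes : ∀ {P : Set} {x} (d : Dec P) → P → x when d ≡ x
when-yes (yes _) _  = refl
when-yes (no ¬p) p  = contradiction p ¬p

when-no : ∀ {P : Set} {x} (d : Dec P) → (P → x ≡ 0) → x when d ≡ 0
when-no (yes p) x≡0 = x≡0 p
when-no (no _)  _   = refl

-- `upper` keeps one representative of every mirror pair of indices; `centre` keeps the value on the
-- mirror line.
upper centre : ∀ {m} → Vector ℕ m → Vector ℕ m
upper  f i = f i when (i Fin.<? opposite i)
centre f i = f i when (i Fin.≟ opposite i)

Symmetric : ∀ {m} → Vector ℕ m → Set
Symmetric f = f ∘ opposite ≗ f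

-- By trichotomy of `i` and `opposite i`, exactly one of the three conditions holds, and symmetry
-- makes the surviving value `f i`.
upper+upper+centre : ∀ {m} {f : Vector ℕ m} → Symmetric f → ∀ i →
  upper f i ℕ.+ upper f (opposite i) ℕ.+ centre f i ≡ f i
upper+upper+centre {f = f} symm i
  rewrite Fin.opposite-involutive i | symm i with Fin.<-cmp i (opposite i)
... | tri< i<i′ i≢i′ i≯i′
  rewrite when-yes {x = f i} (i Fin.<? opposite i) i<i′
        | when-no {x = f i} (opposite i Fin.<? i) (λ p → contradiction p i≯i′)
        | when-no {x = f i} (i Fin.≟ opposite i) (λ p → contradiction p i≢i′)
  = trans (ℕ.+-identityʳ _) (ℕ.+-identityʳ _)
... | tri≈ i≮i′ i≡i′ i≯i′
  rewrite when-no {x = f i} (i Fin.<? opposite i) (λ p → contradiction p i≮i′)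
        | when-no {x = f i} (opposite i Fin.<? i) (λ p → contradiction p i≯i′)
        | when-yes {x = f i} (i Fin.≟ opposite i) i≡i′
  = refl
... | tri> i≮i′ i≢i′ i>i′
  rewrite when-no {x = f i} (i Fin.<? opposite i) (λ p → contradiction p i≮i′)
        | when-yes {x = f i} (opposite i Fin.<? i) i>i′
        | when-no {x = f i} (i Fin.≟ opposite i) (λ p → contradiction p i≢i′)
  = ℕ.+-identityʳ _

centre-symmetric : ∀ {m} {f : Vector ℕ m} → Symmetric f → Symmetric (centre f)
centre-symmetric {f = f} symm i
  rewrite Fin.opposite-involutive i | symm i with i Fin.≟ opposite i
... | yes p = when-yes (opposite i Fin.≟ i) (sym p)
... | no ¬p = when-no (opposite i Fin.≟ i) λ p → contradiction (sym p) ¬p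

∑-opposite : ∀ {m} (f : Vector ℕ m) → ∑ (f ∘ opposite) ≡ ∑ f
∑-opposite f = sym (∑ℕ.sum-permute f Perm.reverse)

∑-reflected : ∀ {m} (f g : Vector ℕ m) →
  ∑ (λ i → f i ℕ.+ f (opposite i) ℕ.+ g i) ≡ ∑ f ℕ.+ ∑ f ℕ.+ ∑ g
∑-reflected f g = begin
  ∑ (λ i → f i ℕ.+ f (opposite i) ℕ.+ g i)      ≡⟨ ∑ℕ.∑-distrib-+ _ g ⟩
  ∑ (λ i → f i ℕ.+ f (opposite i)) ℕ.+ ∑ g      ≡⟨ cong (ℕ._+ ∑ g) (∑ℕ.∑-distrib-+ f (f ∘ opposite)) ⟩
  ∑ f ℕ.+ ∑ (f ∘ opposite) ℕ.+ ∑ g              ≡⟨ cong (λ s → ∑ f ℕ.+ s ℕ.+ ∑ g) (∑-opposite f) ⟩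
  ∑ f ℕ.+ ∑ f ℕ.+ ∑ g                           ∎
  where open ≡-Reasoning

-- Mirror pairs count twice, so modulo 2 only the centre contributes to the sum.
∑-symmetric : ∀ {m} {f : Vector ℕ m} → Symmetric f →
  ∑ f ≡ ∑ (centre f) ℕ.+ ∑ (upper f) ℕ.* 2
∑-symmetric {f = f} symm = begin
  ∑ f                                                  ≡⟨ ∑ℕ.sum-cong-≗ (upper+upper+centre symm) ⟨
  _                                                    ≡⟨ ∑-reflected (upper f) (centre f) ⟩
  ∑ (upper f) ℕ.+ ∑ (upper f) ℕ.+ ∑ (centre f)         ≡⟨ ℕ.+-comm _ (∑ (centre f)) ⟩
  ∑ (centre f) ℕ.+ (∑ (upper f) ℕ.+ ∑ (upper f))       ≡⟨ cong (∑ (centre f) ℕ.+_) (k+k≡k*2 (∑ (upper f))) ⟩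
  ∑ (centre f) ℕ.+ ∑ (upper f) ℕ.* 2                   ∎
  where open ≡-Reasoning

∑-centre-even : ∀ {m} (f : Vector ℕ m) → Even m → ∑ (centre f) ≡ 0
∑-centre-even f even =
  ∑-zero λ i → when-no (i Fin.≟ opposite i) λ fixed → contradiction even (fixed⇒odd fixed)

∑-centre-odd : ∀ {m} .{{_ : NonZero m}} (f : Vector ℕ m) → Odd m → ∑ (centre f) ≡ f (middle m)
∑-centre-odd {m} f odd = trans
  (∑-supported-at (centre f) (middle m) λ i i≢mid →
    when-no (i Fin.≟ opposite i) λ fixed → contradiction (fixed⇒middle fixed) i≢mid)
  (when-yes (middle m Fin.≟ opposite (middle m)) (middle-fixed odd))

-- Treats both parities of `m` at once: an odd `m` has one fixed row, and an even `m` has none but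
-- then `x` vanishes.
∑-centre-const : ∀ {m} .{{_ : NonZero m}} x → (Even m → x ≡ 0) → ∑ {m} (centre (λ _ → x)) ≡ x
∑-centre-const {m} x x≡0 with 2 ∣? m
... | yes even = trans (∑-centre-even {m} (λ _ → x) even) (sym (x≡0 even))
... | no  odd  = ∑-centre-odd {m} (λ _ → x) odd

-- Symmetric matrices over ℕ: necessity and sufficiency of the parity condition.

record Symmetric𝒯ℕ {m n} (ρ : Vector ℕ m) (σ : Vector ℕ n) : Set where
  field
    entry     : Fin m → Fin n → ℕ
    symmetric : ∀ j → Symmetric (λ i → entry i j)
    row-sum   : ∀ i → ∑ (entry i) ≡ ρ i
    col-sum   : ∀ j → ∑ (λ i → entry i j) ≡ σ j

-- By `∑-symmetric` each column sum has the parity of its centre. For even `m` that is 0; for odd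
-- `m` every odd column needs an odd entry, hence at least 1, in the middle row.
parity-necessary : ∀ {m n} .{{_ : NonZero m}} {ρ : Vector ℕ m} {σ : Vector ℕ n} →
  Symmetric𝒯ℕ ρ σ → ParityCondition ρ σ
parity-necessary {m} {n} {ρ} {σ} A = evenCase , oddCase
  where
  open Symmetric𝒯ℕ A

  col : Fin n → Vector ℕ m
  col j i = entry i j

  σ≡ : ∀ j → σ j ≡ ∑ (centre (col j)) ℕ.+ ∑ (upper (col j)) ℕ.* 2
  σ≡ j = trans (sym (col-sum j)) (∑-symmetric (symmetric j))

  evenCase : Even m → ∀ j → Even (σ j)
  evenCase even j = subst Even
    (sym (trans (σ≡ j) (cong (ℕ._+ ∑ (upper (col j)) ℕ.* 2) (∑-centre-even (col j) even))))
    (divides-refl (∑ (upper (col j))))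

  oddCase : Odd m → #odd σ ℕ.≤ ρ (middle m)
  oddCase odd = begin
    #odd σ                               ≡⟨ #odd≡∑%2 σ ⟩
    ∑ (λ j → σ j % 2)                    ≡⟨ ∑ℕ.sum-cong-≗ %2≡ ⟩
    ∑ (λ j → entry (middle m) j % 2)     ≤⟨ ∑-mono-≤ (λ j → m%n≤m (entry (middle m) j) 2) ⟩
    ∑ (entry (middle m))                 ≡⟨ row-sum (middle m) ⟩
    ρ (middle m)                         ∎
    where
    open ℕ.≤-Reasoning
    %2≡ : ∀ j → σ j % 2 ≡ entry (middle m) j % 2
    %2≡ j = trans
      (cong (_% 2) (trans (σ≡ j) (cong (ℕ._+ ∑ (upper (col j)) ℕ.* 2) (∑-centre-odd (col j) odd))))
      ([m+kn]%n≡m%n (entry (middle m) j) (∑ (upper (col j))) 2)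

-- The table `B` has the halved column sums `h` and row sums `ρ′`. Adding its mirror image and the
-- remainders `o` in the fixed row, if there is one, restores `ρ` and `σ`.
parity-sufficient : ∀ {m n} .{{_ : NonZero m}} .{{_ : NonZero n}}
  {ρ : Vector ℕ m} {σ : Vector ℕ n} →
  ∑ ρ ≡ ∑ σ → Symmetric ρ → ParityCondition ρ σ → Symmetric𝒯ℕ ρ σ
parity-sufficient {m} {n} {ρ} {σ} ∑ρ≡∑σ symm (evenCase , oddCase) = record
  { entry     = λ i j → B i j ℕ.+ B (opposite i) j ℕ.+ centre (λ _ → o j) i
  ; symmetric = λ j i → cong₂ ℕ._+_
      (trans (ℕ.+-comm (B (opposite i) j) _)
        (cong (λ k → B k j ℕ.+ B (opposite i) j) (Fin.opposite-involutive i)))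
      (centre-symmetric {f = λ _ → o j} (λ _ → refl) i)
  ; row-sum   = row-sum
  ; col-sum   = col-sum
  }
  where
  open ≡-Reasoning

  o h : Vector ℕ n
  o j = σ j % 2
  h j = σ j / 2

  O : ℕ
  O = ∑ o

  -- Only the value at a fixed row matters; there neither the subtraction nor the division loses
  -- anything, as `ρ-fixed` shows.
  c : Vector ℕ m
  c i = (ρ i ℕ.∸ O) / 2

  o≡0 : Even m → ∀ j → o j ≡ 0
  o≡0 even j = even⇒%2≡0 (evenCase even j)

  ∑σ : ∑ σ ≡ ∑ h ℕ.+ ∑ h ℕ.+ O
  ∑σ = begin
    ∑ σ                                       ≡⟨ ∑ℕ.sum-cong-≗ (λ j → σ≡ (σ j)) ⟩
    ∑ (λ j → (h j ℕ.+ h j) ℕ.+ o j)           ≡⟨ ∑ℕ.∑-distrib-+ _ o ⟩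
    ∑ (λ j → h j ℕ.+ h j) ℕ.+ O               ≡⟨ cong (ℕ._+ O) (∑ℕ.∑-distrib-+ h h) ⟩
    ∑ h ℕ.+ ∑ h ℕ.+ O                         ∎
    where
    σ≡ : ∀ s → s ≡ (s / 2 ℕ.+ s / 2) ℕ.+ s % 2
    σ≡ s = trans (m≡m%n+[m/n]*n s 2)
      (trans (ℕ.+-comm (s % 2) _) (cong (ℕ._+ s % 2) (sym (k+k≡k*2 (s / 2)))))

  -- ∑ ρ ≡ ρ (middle m) and ∑ σ ≡ O modulo 2, so the middle row sum has the parity of O.
  ρ-fixed : ∀ i → i ≡ opposite i → c i ℕ.+ c i ℕ.+ O ≡ ρ i
  ρ-fixed i fixed = begin
    c i ℕ.+ c i ℕ.+ O                    ≡⟨ cong (ℕ._+ O) (k+k≡k*2 (c i)) ⟩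
    c i ℕ.* 2 ℕ.+ O                      ≡⟨ cong (ℕ._+ O) exact ⟩
    (ρ i ℕ.∸ O) ℕ.+ O                    ≡⟨ ℕ.m∸n+n≡m O≤ρ ⟩
    ρ i                                  ∎
    where
    odd : Odd m
    odd = fixed⇒odd fixed

    O≤ρ : O ℕ.≤ ρ i
    O≤ρ rewrite fixed⇒middle fixed = subst (ℕ._≤ ρ (middle m)) (#odd≡∑%2 σ) (oddCase odd)

    ∑ρ : ∑ ρ ≡ ρ i ℕ.+ ∑ (upper ρ) ℕ.* 2
    ∑ρ = trans (∑-symmetric symm) (cong (ℕ._+ ∑ (upper ρ) ℕ.* 2)
      (trans (∑-centre-odd ρ odd) (cong ρ (sym (fixed⇒middle fixed)))))

    u = ∑ (upper ρ)

    total : (ρ i ℕ.∸ O) ℕ.+ u ℕ.* 2 ≡ ∑ h ℕ.* 2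
    total = ℕ.+-cancelʳ-≡ O _ _ (begin
      (ρ i ℕ.∸ O) ℕ.+ u ℕ.* 2 ℕ.+ O      ≡⟨ swap (ρ i ℕ.∸ O) (u ℕ.* 2) O ⟩
      (ρ i ℕ.∸ O) ℕ.+ O ℕ.+ u ℕ.* 2      ≡⟨ cong (ℕ._+ u ℕ.* 2) (ℕ.m∸n+n≡m O≤ρ) ⟩
      ρ i ℕ.+ u ℕ.* 2                    ≡⟨ ∑ρ ⟨
      ∑ ρ                                ≡⟨ ∑ρ≡∑σ ⟩
      ∑ σ                                ≡⟨ ∑σ ⟩
      ∑ h ℕ.+ ∑ h ℕ.+ O                  ≡⟨ cong (ℕ._+ O) (k+k≡k*2 (∑ h)) ⟩
      ∑ h ℕ.* 2 ℕ.+ O                    ∎)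
      where
      swap : ∀ a b c → a ℕ.+ b ℕ.+ c ≡ a ℕ.+ c ℕ.+ b
      swap = solve-∀

    -- `total` gives `u ≤ ∑ h`, so the subtraction is exact and displays the difference as a double.
    diff≡ : ρ i ℕ.∸ O ≡ (∑ h ℕ.∸ u) ℕ.* 2
    diff≡ = begin
      ρ i ℕ.∸ O                                   ≡⟨ ℕ.m+n∸n≡m (ρ i ℕ.∸ O) (u ℕ.* 2) ⟨
      (ρ i ℕ.∸ O) ℕ.+ u ℕ.* 2 ℕ.∸ u ℕ.* 2         ≡⟨ cong (ℕ._∸ u ℕ.* 2) total ⟩
      ∑ h ℕ.* 2 ℕ.∸ u ℕ.* 2                       ≡⟨ ℕ.*-distribʳ-∸ 2 (∑ h) u ⟨
      (∑ h ℕ.∸ u) ℕ.* 2                           ∎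

    exact : c i ℕ.* 2 ≡ ρ i ℕ.∸ O
    exact = begin
      (ρ i ℕ.∸ O) / 2 ℕ.* 2                 ≡⟨ cong (λ d → d / 2 ℕ.* 2) diff≡ ⟩
      (∑ h ℕ.∸ u) ℕ.* 2 / 2 ℕ.* 2           ≡⟨ cong (ℕ._* 2) (m*n/n≡m (∑ h ℕ.∸ u) 2) ⟩
      (∑ h ℕ.∸ u) ℕ.* 2                     ≡⟨ diff≡ ⟨
      ρ i ℕ.∸ O                             ∎

  -- Rows above the mirror line receive all of `ρ`, rows below it nothing, and a fixed row half of
  -- what remains after `O` is removed.
  ρ′ : Vector ℕ m
  ρ′ i = upper ρ i ℕ.+ centre c i

  centre-ρ : ∀ i → centre c i ℕ.+ centre c i ℕ.+ centre (λ _ → O) i ≡ centre ρ i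
  centre-ρ i with i Fin.≟ opposite i
  ... | yes fixed = ρ-fixed i fixed
  ... | no  _     = refl

  ρ′-reflected : ∀ i → ρ′ i ℕ.+ ρ′ (opposite i) ℕ.+ centre (λ _ → O) i ≡ ρ i
  ρ′-reflected i = begin
    ρ′ i ℕ.+ (upper ρ i′ ℕ.+ centre c i′) ℕ.+ z
      ≡⟨ cong (λ d → ρ′ i ℕ.+ (upper ρ i′ ℕ.+ d) ℕ.+ z)
           (centre-symmetric {f = c} (λ k → cong (λ r → (r ℕ.∸ O) / 2) (symm k)) i) ⟩
    (upper ρ i ℕ.+ centre c i) ℕ.+ (upper ρ i′ ℕ.+ centre c i) ℕ.+ z
      ≡⟨ regroup (upper ρ i) (upper ρ i′) (centre c i) z ⟩
    upper ρ i ℕ.+ upper ρ i′ ℕ.+ (centre c i ℕ.+ centre c i ℕ.+ z)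
      ≡⟨ cong (upper ρ i ℕ.+ upper ρ i′ ℕ.+_) (centre-ρ i) ⟩
    upper ρ i ℕ.+ upper ρ i′ ℕ.+ centre ρ i
      ≡⟨ upper+upper+centre symm i ⟩
    ρ i ∎
    where
    i′ = opposite i
    z = centre (λ _ → O) i
    regroup : ∀ a b c d → (a ℕ.+ c) ℕ.+ (b ℕ.+ c) ℕ.+ d ≡ a ℕ.+ b ℕ.+ (c ℕ.+ c ℕ.+ d)
    regroup = solve-∀

  -- Doubling either side and adding `O` gives the common total of `ρ` and `σ`; for even `m` this
  -- uses `O ≡ 0`.
  ∑ρ′≡∑h : ∑ ρ′ ≡ ∑ h
  ∑ρ′≡∑h = ℕ.*-cancelʳ-≡ (∑ ρ′) (∑ h) 2 (begin
    ∑ ρ′ ℕ.* 2            ≡⟨ k+k≡k*2 (∑ ρ′) ⟨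
    ∑ ρ′ ℕ.+ ∑ ρ′         ≡⟨ ℕ.+-cancelʳ-≡ O _ _ doubled ⟩
    ∑ h ℕ.+ ∑ h           ≡⟨ k+k≡k*2 (∑ h) ⟩
    ∑ h ℕ.* 2             ∎)
    where
    doubled : ∑ ρ′ ℕ.+ ∑ ρ′ ℕ.+ O ≡ ∑ h ℕ.+ ∑ h ℕ.+ O
    doubled = begin
      ∑ ρ′ ℕ.+ ∑ ρ′ ℕ.+ O
        ≡⟨ cong (∑ ρ′ ℕ.+ ∑ ρ′ ℕ.+_) (∑-centre-const {m} O (∑-zero ∘ o≡0)) ⟨
      ∑ ρ′ ℕ.+ ∑ ρ′ ℕ.+ ∑ (centre {m} (λ _ → O))
        ≡⟨ ∑-reflected ρ′ (centre {m} (λ _ → O)) ⟨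
      ∑ (λ i → ρ′ i ℕ.+ ρ′ (opposite i) ℕ.+ centre (λ _ → O) i)
        ≡⟨ ∑ℕ.sum-cong-≗ ρ′-reflected ⟩
      ∑ ρ
        ≡⟨ trans ∑ρ≡∑σ ∑σ ⟩
      ∑ h ℕ.+ ∑ h ℕ.+ O ∎

  open Transport ℕ.+-0-commutativeMonoid ℕ-refine using (transport)

  table = transport ρ′ h ∑ρ′≡∑h

  B : Fin m → Fin n → ℕ
  B = proj₁ table

  ∑-centre-comm : ∀ i → ∑ (λ j → centre (λ _ → o j) i) ≡ centre (λ _ → O) i
  ∑-centre-comm i with i Fin.≟ opposite i
  ... | yes _ = refl
  ... | no  _ = ∑-zero {n} λ _ → refl

  row-sum : ∀ i → ∑ (λ j → B i j ℕ.+ B (opposite i) j ℕ.+ centre (λ _ → o j) i) ≡ ρ i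
  row-sum i = begin
    ∑ (λ j → B i j ℕ.+ B (opposite i) j ℕ.+ centre (λ _ → o j) i)
      ≡⟨ ∑ℕ.∑-distrib-+ _ (λ j → centre (λ _ → o j) i) ⟩
    ∑ (λ j → B i j ℕ.+ B (opposite i) j) ℕ.+ ∑ (λ j → centre (λ _ → o j) i)
      ≡⟨ cong₂ ℕ._+_ (∑ℕ.∑-distrib-+ (B i) (B (opposite i))) (∑-centre-comm i) ⟩
    ∑ (B i) ℕ.+ ∑ (B (opposite i)) ℕ.+ centre (λ _ → O) i
      ≡⟨ cong (ℕ._+ centre (λ _ → O) i)
           (cong₂ ℕ._+_ (proj₁ (proj₂ table) i) (proj₁ (proj₂ table) (opposite i))) ⟩
    ρ′ i ℕ.+ ρ′ (opposite i) ℕ.+ centre (λ _ → O) i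
      ≡⟨ ρ′-reflected i ⟩
    ρ i ∎

  col-sum : ∀ j → ∑ (λ i → B i j ℕ.+ B (opposite i) j ℕ.+ centre (λ _ → o j) i) ≡ σ j
  col-sum j = begin
    ∑ (λ i → B i j ℕ.+ B (opposite i) j ℕ.+ centre (λ _ → o j) i)
      ≡⟨ ∑-reflected (λ i → B i j) (centre (λ _ → o j)) ⟩
    b ℕ.+ b ℕ.+ ∑ (centre {m} (λ _ → o j))
      ≡⟨ cong₂ (λ p q → p ℕ.+ p ℕ.+ q) (proj₂ (proj₂ table) j)
           (∑-centre-const {m} (o j) (λ even → o≡0 even j)) ⟩
    h j ℕ.+ h j ℕ.+ o j
      ≡⟨ cong (ℕ._+ o j) (k+k≡k*2 (h j)) ⟩
    h j ℕ.* 2 ℕ.+ o j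
      ≡⟨ ℕ.+-comm (h j ℕ.* 2) (o j) ⟩
    o j ℕ.+ h j ℕ.* 2
      ≡⟨ m≡m%n+[m/n]*n (σ j) 2 ⟨
    σ j ∎
    where
    b = ∑ (λ i → B i j)

-- Nonexpansive operations on the rationals.

p≤∣p∣ : ∀ p → p ℚ.≤ ∣ p ∣
p≤∣p∣ p with ℚ.≤-total 0ℚ p
... | inj₁ 0≤p = ℚ.≤-reflexive (sym (ℚ.0≤p⇒∣p∣≡p 0≤p))
... | inj₂ p≤0 = ℚ.≤-trans p≤0 (ℚ.0≤∣p∣ p)

∣p-q∣≡∣q-p∣ : ∀ p q → ∣ p ℚ.- q ∣ ≡ ∣ q ℚ.- p ∣
∣p-q∣≡∣q-p∣ p q = trans (sym (ℚ.∣-p∣≡∣p∣ (p ℚ.- q))) (cong ∣_∣ (neg-diff p q))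
  where
  neg-diff : ∀ p q → ℚ.- (p ℚ.- q) ≡ q ℚ.- p
  neg-diff = solve 2 (λ p q → :- (p :- q) := q :- p) refl

p≤q+∣p-q∣ : ∀ p q → p ℚ.≤ q ℚ.+ ∣ p ℚ.- q ∣
p≤q+∣p-q∣ p q = ℚ.≤-trans
  (ℚ.≤-reflexive (solve 2 (λ p q → p := q :+ (p :- q)) refl p q))
  (ℚ.+-monoʳ-≤ q (p≤∣p∣ (p ℚ.- q)))

∣p-q∣≤r : ∀ {p q r} → p ℚ.≤ q ℚ.+ r → q ℚ.≤ p ℚ.+ r → ∣ p ℚ.- q ∣ ℚ.≤ r
∣p-q∣≤r {p} {q} {r} p≤q+r q≤p+r with ℚ.∣p∣≡p∨∣p∣≡-p (p ℚ.- q)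
... | inj₁ ≡p-q = subst₂ ℚ._≤_ (sym ≡p-q)
  (solve 2 (λ q r → (q :+ r) :- q := r) refl q r) (ℚ.+-monoˡ-≤ (ℚ.- q) p≤q+r)
... | inj₂ ≡q-p = subst₂ ℚ._≤_
  (trans (solve 2 (λ p q → q :- p := :- (p :- q)) refl p q) (sym ≡q-p))
  (solve 2 (λ p r → (p :+ r) :- p := r) refl p r) (ℚ.+-monoˡ-≤ (ℚ.- p) q≤p+r)

-- The Lipschitz condition with constant 1 for the sum of distances: termwise application then
-- preserves Cauchy sequences and `≈`, with tolerance ε/2 for each argument.
NonExpansive : (ℚ → ℚ → ℚ) → Set
NonExpansive f = ∀ p q r s → ∣ f p q ℚ.- f r s ∣ ℚ.≤ ∣ p ℚ.- r ∣ ℚ.+ ∣ q ℚ.- s ∣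

+-nonExpansive : NonExpansive ℚ._+_
+-nonExpansive p q r s = subst (λ d → ∣ d ∣ ℚ.≤ ∣ p ℚ.- r ∣ ℚ.+ ∣ q ℚ.- s ∣)
  (solve 4 (λ p q r s → (p :- r) :+ (q :- s) := (p :+ q) :- (r :+ s)) refl p q r s)
  (ℚ.∣p+q∣≤∣p∣+∣q∣ (p ℚ.- r) (q ℚ.- s))

-- By symmetry a one-sided bound suffices. The minimum of `r` and `s` is one of them, and `p ⊓ q`
-- lies below the argument in the same place.
⊓-nonExpansive : NonExpansive ℚ._⊓_
⊓-nonExpansive p q r s = ∣p-q∣≤r (bound p q r s)
  (subst (λ d → r ℚ.⊓ s ℚ.≤ p ℚ.⊓ q ℚ.+ d)
    (cong₂ ℚ._+_ (∣p-q∣≡∣q-p∣ r p) (∣p-q∣≡∣q-p∣ s q)) (bound r s p q))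
  where
  bound : ∀ p q r s → p ℚ.⊓ q ℚ.≤ r ℚ.⊓ s ℚ.+ (∣ p ℚ.- r ∣ ℚ.+ ∣ q ℚ.- s ∣)
  bound p q r s with ℚ.⊓-sel r s
  ... | inj₁ ≡r rewrite ≡r = begin
    p ℚ.⊓ q                                 ≤⟨ ℚ.p⊓q≤p p q ⟩
    p                                       ≤⟨ p≤q+∣p-q∣ p r ⟩
    r ℚ.+ ∣ p ℚ.- r ∣                       ≡⟨ cong (r ℚ.+_) (ℚ.+-identityʳ _) ⟨
    r ℚ.+ (∣ p ℚ.- r ∣ ℚ.+ 0ℚ)              ≤⟨ ℚ.+-monoʳ-≤ r (ℚ.+-monoʳ-≤ ∣ p ℚ.- r ∣ (ℚ.0≤∣p∣ (q ℚ.- s))) ⟩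
    r ℚ.+ (∣ p ℚ.- r ∣ ℚ.+ ∣ q ℚ.- s ∣)     ∎
    where open ℚ.≤-Reasoning
  ... | inj₂ ≡s rewrite ≡s = begin
    p ℚ.⊓ q                                 ≤⟨ ℚ.p⊓q≤q p q ⟩
    q                                       ≤⟨ p≤q+∣p-q∣ q s ⟩
    s ℚ.+ ∣ q ℚ.- s ∣                       ≡⟨ cong (s ℚ.+_) (ℚ.+-identityˡ _) ⟨
    s ℚ.+ (0ℚ ℚ.+ ∣ q ℚ.- s ∣)              ≤⟨ ℚ.+-monoʳ-≤ s (ℚ.+-monoˡ-≤ ∣ q ℚ.- s ∣ (ℚ.0≤∣p∣ (p ℚ.- r))) ⟩
    s ℚ.+ (∣ p ℚ.- r ∣ ℚ.+ ∣ q ℚ.- s ∣)     ∎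
    where open ℚ.≤-Reasoning

⊔0-nonExpansive : ∀ p q → ∣ p ℚ.⊔ 0ℚ ℚ.- (q ℚ.⊔ 0ℚ) ∣ ℚ.≤ ∣ p ℚ.- q ∣
⊔0-nonExpansive p q = ∣p-q∣≤r (bound p q)
  (subst (λ d → q ℚ.⊔ 0ℚ ℚ.≤ p ℚ.⊔ 0ℚ ℚ.+ d) (∣p-q∣≡∣q-p∣ q p) (bound q p))
  where
  bound : ∀ p q → p ℚ.⊔ 0ℚ ℚ.≤ q ℚ.⊔ 0ℚ ℚ.+ ∣ p ℚ.- q ∣
  bound p q = ℚ.⊔-lub
    (ℚ.≤-trans (p≤q+∣p-q∣ p q) (ℚ.+-monoˡ-≤ ∣ p ℚ.- q ∣ (ℚ.p≤p⊔q q 0ℚ)))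
    (ℚ.+-mono-≤ (ℚ.p≤q⊔p q 0ℚ) (ℚ.0≤∣p∣ (p ℚ.- q)))

infixl 6 _∸ℚ_

_∸ℚ_ : ℚ → ℚ → ℚ
p ∸ℚ q = (p ℚ.- q) ℚ.⊔ 0ℚ

∸-nonExpansive : NonExpansive _∸ℚ_
∸-nonExpansive p q r s = ℚ.≤-trans (⊔0-nonExpansive (p ℚ.- q) (r ℚ.- s))
  (subst₂ ℚ._≤_
    (cong ∣_∣ (solve 4 (λ p q r s → (p :- r) :- (q :- s) := (p :- q) :- (r :- s)) refl p q r s))
    refl
    (ℚ.∣p-q∣≤∣p∣+∣q∣ (p ℚ.- r) (q ℚ.- s)))

½ε+½ε≡ε : ∀ ε → ½ ℚ.* ε ℚ.+ ½ ℚ.* ε ≡ ε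
½ε+½ε≡ε = solve 1 (λ ε → con ½ :* ε :+ con ½ :* ε := ε) refl

avgℚ : ℚ → ℚ → ℚ
avgℚ p q = ½ ℚ.* (p ℚ.+ q)

avg-nonExpansive : NonExpansive avgℚ
avg-nonExpansive p q r s = begin
  ∣ avgℚ p q ℚ.- avgℚ r s ∣            ≡⟨ cong ∣_∣ (solve 4 (λ p q r s →
    con ½ :* (p :+ q) :- con ½ :* (r :+ s) := con ½ :* ((p :+ q) :- (r :+ s))) refl p q r s) ⟩
  ∣ ½ ℚ.* d ∣                          ≡⟨ ℚ.∣p*q∣≡∣p∣*∣q∣ ½ d ⟩
  ½ ℚ.* ∣ d ∣                          ≡⟨ ℚ.+-identityˡ _ ⟨
  0ℚ ℚ.+ ½ ℚ.* ∣ d ∣                   ≤⟨ ℚ.+-monoˡ-≤ (½ ℚ.* ∣ d ∣) 0≤½∣d∣ ⟩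
  ½ ℚ.* ∣ d ∣ ℚ.+ ½ ℚ.* ∣ d ∣          ≡⟨ ½ε+½ε≡ε ∣ d ∣ ⟩
  ∣ d ∣                                ≤⟨ +-nonExpansive p q r s ⟩
  ∣ p ℚ.- r ∣ ℚ.+ ∣ q ℚ.- s ∣          ∎
  where
  open ℚ.≤-Reasoning
  d = (p ℚ.+ q) ℚ.- (r ℚ.+ s)
  0≤½∣d∣ : 0ℚ ℚ.≤ ½ ℚ.* ∣ d ∣
  0≤½∣d∣ = subst (0ℚ ℚ.≤_) (ℚ.∣p*q∣≡∣p∣*∣q∣ ½ d) (ℚ.0≤∣p∣ (½ ℚ.* d))

-- The order of ℚ can be decided, so cases are allowed here; the reals inherit the identity termwise
-- without a decision.
⊓+∸≡ˡ : ∀ p q → p ℚ.⊓ q ℚ.+ (p ∸ℚ q) ≡ p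
⊓+∸≡ˡ p q with ℚ.≤-total p q
... | inj₁ p≤q = trans
  (cong₂ ℚ._+_ (ℚ.p≤q⇒p⊓q≡p p≤q)
    (ℚ.p≤q⇒p⊔q≡q (subst (p ℚ.- q ℚ.≤_) (ℚ.+-inverseʳ q) (ℚ.+-monoˡ-≤ (ℚ.- q) p≤q))))
  (ℚ.+-identityʳ p)
... | inj₂ q≤p = trans
  (cong₂ ℚ._+_ (ℚ.p≥q⇒p⊓q≡q q≤p)
    (ℚ.p≥q⇒p⊔q≡p (subst (ℚ._≤ p ℚ.- q) (ℚ.+-inverseʳ q) (ℚ.+-monoˡ-≤ (ℚ.- q) q≤p))))
  (solve 2 (λ p q → q :+ (p :- q) := p) refl p q)

⊓+∸≡ʳ : ∀ p q → p ℚ.⊓ q ℚ.+ (q ∸ℚ p) ≡ q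
⊓+∸≡ʳ p q = trans (cong (ℚ._+ (q ∸ℚ p)) (ℚ.⊓-comm p q)) (⊓+∸≡ˡ q p)

0<½ε : ∀ {ε} → 0ℚ ℚ.< ε → 0ℚ ℚ.< ½ ℚ.* ε
0<½ε {ε} 0<ε = subst (ℚ._< ½ ℚ.* ε) (ℚ.*-zeroʳ ½) (ℚ.*-monoʳ-<-pos ½ 0<ε)

-- Equality of Cauchy reals and the lifting of nonexpansive operations.

Eventually : (ℕ → Set) → Set
Eventually P = ∃ λ N → ∀ i → N ℕ.≤ i → P i

zipEventually : ∀ {P Q R : ℕ → Set} → (∀ i → P i → Q i → R i) →
  Eventually P → Eventually Q → Eventually R
zipEventually f (M , p) (N , q) = M ℕ.⊔ N , λ i ≤i →
  f i (p i (ℕ.m⊔n≤o⇒m≤o M N ≤i)) (q i (ℕ.m⊔n≤o⇒n≤o M N ≤i))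

mapEventually : ∀ {P Q : ℕ → Set} → (∀ i → P i → Q i) → Eventually P → Eventually Q
mapEventually f (N , p) = N , λ i ≤i → f i (p i ≤i)

-- Turns identities of ℚ into laws of ℝ without estimates.
pointwise : ∀ {x y} → (∀ i → seq x i ≡ seq y i) → x ≈ y
pointwise {x} {y} eq = mk≈ λ ε 0<ε → 0 , λ i _ →
  subst (λ d → ∣ d ∣ ℚ.< ε)
    (sym (trans (cong (ℚ._- seq y i) (eq i)) (ℚ.+-inverseʳ (seq y i)))) 0<ε

≈-refl : ∀ {x} → x ≈ x
≈-refl = pointwise λ _ → refl

≈-sym : ∀ {x y} → x ≈ y → y ≈ x
≈-sym {x} {y} (mk≈ close) = mk≈ λ ε 0<ε →
  mapEventually (λ i → subst (ℚ._< ε) (∣p-q∣≡∣q-p∣ (seq x i) (seq y i))) (close ε 0<ε)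

≈-trans : ∀ {x y z} → x ≈ y → y ≈ z → x ≈ z
≈-trans {x} {y} {z} (mk≈ xy) (mk≈ yz) = mk≈ λ ε 0<ε → zipEventually
  (λ i p q → subst₂ (λ d e → ∣ d ∣ ℚ.< e)
    (solve 3 (λ x y z → (x :- y) :+ (y :- z) := x :- z) refl (seq x i) (seq y i) (seq z i))
    (½ε+½ε≡ε ε)
    (ℚ.≤-<-trans (ℚ.∣p+q∣≤∣p∣+∣q∣ (seq x i ℚ.- seq y i) (seq y i ℚ.- seq z i)) (ℚ.+-mono-< p q)))
  (xy (½ ℚ.* ε) (0<½ε 0<ε)) (yz (½ ℚ.* ε) (0<½ε 0<ε))

module _ (f : ℚ → ℚ → ℚ) (f-nonExp : NonExpansive f) where

  shrink : ∀ p q r s {ε} → ∣ p ℚ.- r ∣ ℚ.< ½ ℚ.* ε → ∣ q ℚ.- s ∣ ℚ.< ½ ℚ.* ε →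
    ∣ f p q ℚ.- f r s ∣ ℚ.< ε
  shrink p q r s {ε} pr qs = subst (∣ f p q ℚ.- f r s ∣ ℚ.<_) (½ε+½ε≡ε ε)
    (ℚ.≤-<-trans (f-nonExp p q r s) (ℚ.+-mono-< pr qs))

  abstract
    lift₂-cauchy : ∀ x y → IsCauchy x → IsCauchy y → IsCauchy (λ i → f (x i) (y i))
    lift₂-cauchy x y cx cy ε 0<ε =
      let M , close-x = cx (½ ℚ.* ε) (0<½ε 0<ε)
          N , close-y = cy (½ ℚ.* ε) (0<½ε 0<ε)
      in M ℕ.⊔ N , λ i j ≤i ≤j → shrink (x i) (y i) (x j) (y j)
        (close-x i j (ℕ.m⊔n≤o⇒m≤o M N ≤i) (ℕ.m⊔n≤o⇒m≤o M N ≤j))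
        (close-y i j (ℕ.m⊔n≤o⇒n≤o M N ≤i) (ℕ.m⊔n≤o⇒n≤o M N ≤j))

  lift₂ : ℝ → ℝ → ℝ
  lift₂ x y = mkℝ (λ i → f (seq x i) (seq y i)) (lift₂-cauchy (seq x) (seq y) (cauchy x) (cauchy y))

  cong-close : ∀ {x x′ y y′} → x ≈ x′ → y ≈ y′ → ∀ ε → 0ℚ ℚ.< ε →
    Eventually λ i → ∣ f (seq x i) (seq y i) ℚ.- f (seq x′ i) (seq y′ i) ∣ ℚ.< ε
  cong-close (mk≈ xx′) (mk≈ yy′) ε 0<ε =
    zipEventually (λ i → shrink _ _ _ _) (xx′ (½ ℚ.* ε) (0<½ε 0<ε)) (yy′ (½ ℚ.* ε) (0<½ε 0<ε))

+-cong : ∀ {x x′ y y′} → x ≈ x′ → y ≈ y′ → x + y ≈ x′ + y′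
+-cong xx′ yy′ = mk≈ (cong-close ℚ._+_ +-nonExpansive xx′ yy′)

_⊓_ _∸_ avg : ℝ → ℝ → ℝ
_⊓_ = lift₂ ℚ._⊓_ ⊓-nonExpansive
_∸_ = lift₂ _∸ℚ_ ∸-nonExpansive
avg = lift₂ avgℚ avg-nonExpansive

avg-cong : ∀ {x x′ y y′} → x ≈ x′ → y ≈ y′ → avg x y ≈ avg x′ y′
avg-cong xx′ yy′ = mk≈ (cong-close avgℚ avg-nonExpansive xx′ yy′)

avg-idem : ∀ x → avg x x ≈ x
avg-idem x = pointwise λ i →
  solve 1 (λ p → con ½ :* (p :+ p) := p) refl (seq x i)

avg-comm : ∀ x y → avg x y ≈ avg y x
avg-comm x y = pointwise λ i → cong (½ ℚ.*_) (ℚ.+-comm (seq x i) (seq y i))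

avg-+ : ∀ x y z w → avg x y + avg z w ≈ avg (x + z) (y + w)
avg-+ x y z w = pointwise λ i →
  solve 4 (λ p q r s → con ½ :* (p :+ q) :+ con ½ :* (r :+ s) := con ½ :* ((p :+ r) :+ (q :+ s)))
    refl (seq x i) (seq y i) (seq z i) (seq w i)

-- The untruncated differences differ by `(x + y) - (z + w)`, which tends to 0, and truncation at 0
-- does not enlarge distances.
difference-cong : ∀ {x y z w} → x + y ≈ z + w → (x ∸ z) ≈ (w ∸ y)
difference-cong {x} {y} {z} {w} (mk≈ close) = mk≈ λ ε 0<ε → mapEventually
  (λ i → ℚ.≤-<-trans (ℚ.≤-trans
    (⊔0-nonExpansive (seq x i ℚ.- seq z i) (seq w i ℚ.- seq y i))
    (ℚ.≤-reflexive (cong ∣_∣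
      (solve 4 (λ x y z w → (x :- z) :- (w :- y) := (x :+ y) :- (z :+ w)) refl
        (seq x i) (seq y i) (seq z i) (seq w i))))))
  (close ε 0<ε)

+-0-commutativeMonoid : CommutativeMonoid _ _
+-0-commutativeMonoid = record
  { Carrier = ℝ ; _≈_ = _≈_ ; _∙_ = _+_ ; ε = 0ℝ
  ; isCommutativeMonoid = record
    { isMonoid = record
      { isSemigroup = record
        { isMagma = record
          { isEquivalence = record { refl = ≈-refl ; sym = ≈-sym ; trans = ≈-trans }
          ; ∙-cong = +-cong }
        ; assoc = λ x y z → pointwise λ i → ℚ.+-assoc (seq x i) (seq y i) (seq z i) }
      ; identity = (λ x → pointwise λ i → ℚ.+-identityˡ (seq x i))
                 , (λ x → pointwise λ i → ℚ.+-identityʳ (seq x i)) }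
    ; comm = λ x y → pointwise λ i → ℚ.+-comm (seq x i) (seq y i) } }

open import Relation.Binary.Reasoning.Setoid (CommutativeMonoid.setoid +-0-commutativeMonoid)

module ∑ℝ = CommutativeMonoidSum +-0-commutativeMonoid

-- Nonnegative reals and their refinement property.

+-nonneg : ∀ {x y} → 0ℝ ≤ x → 0ℝ ≤ y → 0ℝ ≤ x + y
+-nonneg {x} {y} (mk≤ 0≤x) (mk≤ 0≤y) = mk≤ λ ε 0<ε → zipEventually
  (λ i p q → subst (0ℚ ℚ.<_)
    (trans
      (solve 3 (λ p q e → (p :+ e) :+ (q :+ e) := (p :+ q) :+ (e :+ e)) refl
        (seq x i) (seq y i) (½ ℚ.* ε))
      (cong (seq x i ℚ.+ seq y i ℚ.+_) (½ε+½ε≡ε ε)))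
    (ℚ.+-mono-< p q))
  (0≤x (½ ℚ.* ε) (0<½ε 0<ε)) (0≤y (½ ℚ.* ε) (0<½ε 0<ε))

⊓-nonneg : ∀ {x y} → 0ℝ ≤ x → 0ℝ ≤ y → 0ℝ ≤ (x ⊓ y)
⊓-nonneg {x} {y} (mk≤ 0≤x) (mk≤ 0≤y) = mk≤ λ ε 0<ε →
  zipEventually (λ i → step (seq x i) (seq y i) ε) (0≤x ε 0<ε) (0≤y ε 0<ε)
  where
  step : ∀ p q ε → 0ℚ ℚ.< p ℚ.+ ε → 0ℚ ℚ.< q ℚ.+ ε → 0ℚ ℚ.< p ℚ.⊓ q ℚ.+ ε
  step p q ε 0<p 0<q with ℚ.⊓-sel p q
  ... | inj₁ ≡p = subst (λ r → 0ℚ ℚ.< r ℚ.+ ε) (sym ≡p) 0<p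
  ... | inj₂ ≡q = subst (λ r → 0ℚ ℚ.< r ℚ.+ ε) (sym ≡q) 0<q

∸-nonneg : ∀ x y → 0ℝ ≤ (x ∸ y)
∸-nonneg x y = mk≤ λ ε 0<ε → 0 , λ i _ →
  ℚ.+-mono-≤-< (ℚ.p≤q⊔p (seq x i ℚ.- seq y i) 0ℚ) 0<ε

avg-nonneg : ∀ {x y} → 0ℝ ≤ x → 0ℝ ≤ y → 0ℝ ≤ avg x y
avg-nonneg {x} {y} (mk≤ 0≤x) (mk≤ 0≤y) = mk≤ λ ε 0<ε → zipEventually
  (λ i p q → subst (0ℚ ℚ.<_)
    (solve 3 (λ p q e → con ½ :* ((p :+ e) :+ (q :+ e)) := con ½ :* (p :+ q) :+ e) refl
      (seq x i) (seq y i) ε)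
    (0<½ε (ℚ.+-mono-< p q)))
  (0≤x ε 0<ε) (0≤y ε 0<ε)

-- Proofs of nonnegativity travel with the elements and are ignored by equality, so `transport`
-- delivers nonnegative entries directly.
ℝ≥0 : CommutativeMonoid _ _
ℝ≥0 = record
  { Carrier = Σ ℝ (0ℝ ≤_)
  ; _≈_ = λ x y → proj₁ x ≈ proj₁ y
  ; _∙_ = λ x y → proj₁ x + proj₁ y , +-nonneg (proj₂ x) (proj₂ y)
  ; ε = 0ℝ , mk≤ λ ε 0<ε → 0 , λ _ _ → subst (0ℚ ℚ.<_) (sym (ℚ.+-identityˡ ε)) 0<ε
  ; isCommutativeMonoid = record
    { isMonoid = record
      { isSemigroup = record
        { isMagma = record
          { isEquivalence = record { refl = ≈-refl ; sym = ≈-sym ; trans = ≈-trans }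
          ; ∙-cong = +-cong }
        ; assoc = λ x y z → assoc (proj₁ x) (proj₁ y) (proj₁ z) }
      ; identity = (λ x → identityˡ (proj₁ x)) , (λ x → identityʳ (proj₁ x)) }
    ; comm = λ x y → comm (proj₁ x) (proj₁ y) } }
  where open CommutativeMonoid +-0-commutativeMonoid using (assoc; comm; identityˡ; identityʳ)

module ∑ℝ≥0 = CommutativeMonoidSum ℝ≥0

-- The witnesses are those used for ℕ, and no comparison of `a` with `c` is made. The sums for `a`
-- and `c` hold termwise; those for `b` and `d` rest on `eq` through `difference-cong`.
ℝ≥0-refine : HasRefinement ℝ≥0
ℝ≥0-refine (a , 0≤a) (b , 0≤b) (c , 0≤c) (d , 0≤d) eq =
  (a ⊓ c , ⊓-nonneg 0≤a 0≤c) ,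
  (a ∸ c , ∸-nonneg a c) ,
  (c ∸ a , ∸-nonneg c a) ,
  (b ⊓ d , ⊓-nonneg 0≤b 0≤d) ,
  pointwise (λ i → ⊓+∸≡ˡ (seq a i) (seq c i)) ,
  ≈-trans (+-cong (difference-cong (≈-sym eq)) ≈-refl)
    (pointwise λ i → trans (ℚ.+-comm (seq b i ∸ℚ seq d i) _) (⊓+∸≡ˡ (seq b i) (seq d i))) ,
  pointwise (λ i → ⊓+∸≡ʳ (seq a i) (seq c i)) ,
  ≈-trans (+-cong (difference-cong eq) ≈-refl)
    (pointwise λ i → trans (ℚ.+-comm (seq d i ∸ℚ seq b i) _) (⊓+∸≡ʳ (seq b i) (seq d i)))

-- Real matrices with given sums, and symmetrisation by averaging.

∑-proj₁ : ∀ {n} (f : Vector (Σ ℝ (0ℝ ≤_)) n) → proj₁ (∑ℝ≥0.sum f) ≡ sum (proj₁ ∘ f)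
∑-proj₁ {zero}  f = refl
∑-proj₁ {suc n} f = cong (_+_ (proj₁ (f zero))) (∑-proj₁ (f ∘ suc))

∑-avg : ∀ {n} (f g : Vector ℝ n) → sum (λ i → avg (f i) (g i)) ≈ avg (sum f) (sum g)
∑-avg {zero}  f g = ≈-sym (avg-idem 0ℝ)
∑-avg {suc n} f g = ≈-trans (+-cong ≈-refl (∑-avg (f ∘ suc) (g ∘ suc)))
  (avg-+ (f zero) (g zero) (sum (f ∘ suc)) (sum (g ∘ suc)))

𝒯-nonempty : ∀ {m n} .{{_ : NonZero m}} .{{_ : NonZero n}} {R : Vector ℝ m} {S : Vector ℝ n} →
  Nonneg R → Nonneg S → sum R ≈ sum S → NonEmpty (𝒯 R S)
𝒯-nonempty {R = R} {S} 0≤R 0≤S eq =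
  let A , rows , cols = transport R⁺ S⁺
        (subst₂ _≈_ (sym (∑-proj₁ R⁺)) (sym (∑-proj₁ S⁺)) eq)
  in (λ i j → proj₁ (A i j)) , record
    { nonneg  = λ i j → proj₂ (A i j)
    ; row-sum = λ i → subst (_≈ R i) (∑-proj₁ (A i)) (rows i)
    ; col-sum = λ j → subst (_≈ S j) (∑-proj₁ (λ i → A i j)) (cols j) }
  where
  open Transport ℝ≥0 ℝ≥0-refine using (transport)
  R⁺ = λ i → R i , 0≤R i
  S⁺ = λ j → S j , 0≤S j

-- For palindromic `R` the reflection maps `𝒯 R S` to itself. This set is convex, so it contains the
-- midpoint of `B` and `r₀ B`, which `r₀` fixes.
palindromic⇒𝒯⁰ : ∀ {m n} {R : Vector ℝ m} {S : Vector ℝ n} →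
  NonEmpty (𝒯 R S) → Palindromic R → NonEmpty (𝒯⁰ R S)
palindromic⇒𝒯⁰ {R = R} {S} (B , B∈𝒯) pal =
  (λ i j → avg (B i j) (r₀ B i j)) ,
  record
    { nonneg  = λ i j → avg-nonneg (nonneg i j) (nonneg (opposite i) j)
    ; row-sum = λ i → begin
        sum (λ j → avg (B i j) (r₀ B i j))         ≈⟨ ∑-avg (B i) (r₀ B i) ⟩
        avg (sum (B i)) (sum (B (opposite i)))     ≈⟨ avg-cong (row-sum i) (row-sum (opposite i)) ⟩
        avg (R i) (R (opposite i))                 ≈⟨ avg-cong ≈-refl (pal i) ⟨
        avg (R i) (R i)                            ≈⟨ avg-idem (R i) ⟩
        R i                                        ∎
    ; col-sum = λ j → begin
        sum (λ i → avg (B i j) (r₀ B i j))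
          ≈⟨ ∑-avg (λ i → B i j) (λ i → r₀ B i j) ⟩
        avg (sum (λ i → B i j)) (sum (λ i → r₀ B i j))
          ≈⟨ avg-cong ≈-refl (∑ℝ.sum-permute (λ i → B i j) Perm.reverse) ⟨
        avg (sum (λ i → B i j)) (sum (λ i → B i j))
          ≈⟨ avg-idem _ ⟩
        sum (λ i → B i j)
          ≈⟨ col-sum j ⟩
        S j ∎ } ,
  λ i j → subst (λ k → avg (B (opposite i) j) (B k j) ≈ avg (B i j) (B (opposite i) j))
    (sym (Fin.opposite-involutive i)) (avg-comm (B (opposite i) j) (B i j))
  where open 𝒯 B∈𝒯

𝒯⁰⇒palindromic : ∀ {m n} {R : Vector ℝ m} {S : Vector ℝ n} →
  NonEmpty (𝒯⁰ R S) → Palindromic R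
𝒯⁰⇒palindromic {R = R} (A , A∈𝒯 , symm) i = begin
  R i                     ≈⟨ row-sum i ⟨
  sum (A i)               ≈⟨ ∑ℝ.sum-cong-≋ (symm i) ⟨
  sum (A (opposite i))    ≈⟨ row-sum (opposite i) ⟩
  R (opposite i)          ∎
  where open 𝒯 A∈𝒯

-- Rationals, integers and naturals inside the reals.

fromℚ-injective : ∀ {p q} → fromℚ p ≈ fromℚ q → p ≡ q
-- Distinct constants stay at distance `∣ p - q ∣`, so taking that as ε is contradictory; decidable
-- equality of ℚ removes the double negation.
fromℚ-injective {p} {q} (mk≈ close) = decidable-stable (p ℚ.≟ q) λ p≢q →
  let d≢0 : ∣ p ℚ.- q ∣ ≢ 0ℚ
      d≢0 d≡0 = p≢q (trans
        (solve 2 (λ p q → p := (p :- q) :+ q) refl p q)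
        (trans (cong (ℚ._+ q) (ℚ.∣p∣≡0⇒p≡0 (p ℚ.- q) d≡0)) (ℚ.+-identityˡ q)))
      0<d = ℚ.≰⇒> λ d≤0 → d≢0 (ℚ.≤-antisym d≤0 (ℚ.0≤∣p∣ (p ℚ.- q)))
      N , d<d = close ∣ p ℚ.- q ∣ 0<d
  in ℚ.<-irrefl refl (d<d N ℕ.≤-refl)

-- A negative `q` is refuted by the tolerance `- q`, for which the bound reads `0 < q - q`.
fromℚ-cancel-0≤ : ∀ {q} → 0ℝ ≤ fromℚ q → 0ℚ ℚ.≤ q
fromℚ-cancel-0≤ {q} (mk≤ below) = ℚ.≮⇒≥ λ q<0 →
  let N , 0<q-q = below (ℚ.- q) (ℚ.neg-antimono-< q<0)
  in ℚ.<-irrefl (sym (ℚ.+-inverseʳ q)) (0<q-q N ℕ.≤-refl)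

-- `z / 1` is normalised by a gcd that does not compute for a variable `z`; among unnormalised
-- fractions it can be replaced by numerator `z` over 1.
toℚᵘ-integer : ∀ z → ℚ.toℚᵘ (z ℚ./ 1) ℚᵘ.≃ ℚᵘ.mkℚᵘ z 0
toℚᵘ-integer z = ℚ.toℚᵘ-fromℚᵘ (ℚᵘ.mkℚᵘ z 0)

/1-injective : ∀ {z w} → z ℚ./ 1 ≡ w ℚ./ 1 → z ≡ w
/1-injective {z} {w} eq
  with ℚᵘ.*≡* z1≡w1 ← ℚᵘ.≃-trans (ℚᵘ.≃-sym (toℚᵘ-integer z))
    (ℚᵘ.≃-trans (ℚ.toℚᵘ-cong eq) (toℚᵘ-integer w))
  = trans (sym (ℤ.*-identityʳ z)) (trans z1≡w1 (ℤ.*-identityʳ w))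

/1-homo-+ : ∀ z w → (z ℤ.+ w) ℚ./ 1 ≡ z ℚ./ 1 ℚ.+ w ℚ./ 1
/1-homo-+ z w = ℚ.toℚᵘ-injective (ℚᵘ.≃-trans (toℚᵘ-integer (z ℤ.+ w))
  (ℚᵘ.≃-trans
    (ℚᵘ.*≡* (cong (ℤ._* + 1) (sym (cong₂ ℤ._+_ (ℤ.*-identityʳ z) (ℤ.*-identityʳ w)))))
    (ℚᵘ.≃-sym (ℚᵘ.≃-trans (ℚ.toℚᵘ-homo-+ (z ℚ./ 1) (w ℚ./ 1))
      (ℚᵘ.+-cong (toℚᵘ-integer z) (toℚᵘ-integer w))))))

fromℕ-injective : ∀ {k l} → fromℕ k ≈ fromℕ l → k ≡ l
fromℕ-injective eq = ℤ.+-injective (/1-injective (fromℚ-injective eq))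

fromℕ-nonneg : ∀ k → 0ℝ ≤ fromℕ k
fromℕ-nonneg k = mk≤ λ ε 0<ε → 0 , λ _ _ →
  ℚ.+-mono-≤-< (ℚ.nonNegative⁻¹ (+ k ℚ./ 1) {{ℚ.normalize-nonNeg k 1}}) 0<ε

fromℕ-homo-∑ : ∀ {n} (f : Vector ℕ n) → fromℕ (∑ f) ≈ sum (fromℕ ∘ f)
fromℕ-homo-∑ {zero}  f = ≈-refl
fromℕ-homo-∑ {suc n} f = ≈-trans
  (pointwise λ _ → /1-homo-+ (+ f zero) (+ ∑ (f ∘ suc)))
  (+-cong (≈-refl {fromℕ (f zero)}) (fromℕ-homo-∑ (f ∘ suc)))

0≤-resp-≈ : ∀ {x y} → x ≈ y → 0ℝ ≤ x → 0ℝ ≤ y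
0≤-resp-≈ {x} {y} (mk≈ close) (mk≤ below) = mk≤ λ ε 0<ε → zipEventually
  (λ i d<½ε 0<x → subst (0ℚ ℚ.<_)
    (trans (ℚ.+-assoc (seq y i) (½ ℚ.* ε) (½ ℚ.* ε)) (cong (seq y i ℚ.+_) (½ε+½ε≡ε ε)))
    (ℚ.<-trans 0<x (ℚ.+-monoˡ-< (½ ℚ.* ε)
      (ℚ.≤-<-trans (p≤q+∣p-q∣ (seq x i) (seq y i)) (ℚ.+-monoʳ-< (seq y i) d<½ε)))))
  (close (½ ℚ.* ε) (0<½ε 0<ε)) (below (½ ℚ.* ε) (0<½ε 0<ε))

0≰-[1+k]/1 : ∀ k → ¬ (0ℚ ℚ.≤ -[1+ k ] ℚ./ 1)
0≰-[1+k]/1 k 0≤z = impossible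
  (ℚᵘ.≤-respʳ-≃ {ℚᵘ.0ℚᵘ} (toℚᵘ-integer -[1+ k ]) (ℚ.toℚᵘ-mono-≤ 0≤z))
  where
  impossible : ¬ (ℚᵘ.0ℚᵘ ℚᵘ.≤ ℚᵘ.mkℚᵘ -[1+ k ] 0)
  impossible (ℚᵘ.*≤* ())

-- The sign is read off the integer witness, so no order between reals has to be decided.
nonneg-integer⇒fromℕ : ∀ {x} → 0ℝ ≤ x → IsInteger x → ∃ λ k → x ≈ fromℕ k
nonneg-integer⇒fromℕ _ (+ k , x≈k) = k , x≈k
nonneg-integer⇒fromℕ 0≤x (-[1+ k ] , x≈z) =
  contradiction (fromℚ-cancel-0≤ (0≤-resp-≈ x≈z 0≤x)) (0≰-[1+k]/1 k)

-- Passage between integral real matrices and matrices over ℕ.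

module _ {m n} .{{_ : NonZero m}} .{{_ : NonZero n}} {R : Vector ℝ m} {S : Vector ℝ n}
  (ρ : Vector ℕ m) (σ : Vector ℕ n)
  (R≈ρ : ∀ i → R i ≈ fromℕ (ρ i)) (S≈σ : ∀ j → S j ≈ fromℕ (σ j)) where

  -- Each entry chooses its natural number separately, and the real equations hold only up to `≈`;
  -- injectivity of `fromℕ` makes mirror entries and all sums agree on the nose.
  𝒯⁰ℤ⇒symmetric𝒯ℕ : NonEmpty (𝒯⁰ℤ R S) → Symmetric𝒯ℕ ρ σ
  𝒯⁰ℤ⇒symmetric𝒯ℕ (A , (A∈𝒯 , symm) , integral) = record
    { entry     = λ i j → proj₁ (natural i j)
    ; symmetric = λ j i → fromℕ-injective
        (≈-trans (≈-sym (A≈ (opposite i) j)) (≈-trans (symm i j) (A≈ i j)))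
    ; row-sum   = λ i → fromℕ-injective (∑-natural (A≈ i) (≈-trans (row-sum i) (R≈ρ i)))
    ; col-sum   = λ j → fromℕ-injective (∑-natural (λ i → A≈ i j) (≈-trans (col-sum j) (S≈σ j)))
    }
    where
    open 𝒯 A∈𝒯
    natural : ∀ i j → ∃ λ k → A i j ≈ fromℕ k
    natural i j = nonneg-integer⇒fromℕ (nonneg i j) (integral i j)
    A≈ : ∀ i j → A i j ≈ fromℕ (proj₁ (natural i j))
    A≈ i j = proj₂ (natural i j)
    ∑-natural : ∀ {k} {x : Vector ℝ k} {f : Vector ℕ k} {s} →
      (∀ i → x i ≈ fromℕ (f i)) → sum x ≈ s → fromℕ (∑ f) ≈ s
    ∑-natural {f = f} x≈f ∑x≈s =
      ≈-trans (fromℕ-homo-∑ f) (≈-trans (≈-sym (∑ℝ.sum-cong-≋ x≈f)) ∑x≈s)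

  symmetric𝒯ℕ⇒𝒯⁰ℤ : Symmetric𝒯ℕ ρ σ → NonEmpty (𝒯⁰ℤ R S)
  symmetric𝒯ℕ⇒𝒯⁰ℤ A =
    (λ i j → fromℕ (entry i j)) ,
    (record
      { nonneg  = λ i j → fromℕ-nonneg (entry i j)
      ; row-sum = λ i → ≈-trans (≈-sym (fromℕ-homo-∑ (entry i)))
          (subst (λ k → fromℕ k ≈ R i) (sym (row-sum i)) (≈-sym (R≈ρ i)))
      ; col-sum = λ j → ≈-trans (≈-sym (fromℕ-homo-∑ (λ i → entry i j)))
          (subst (λ k → fromℕ k ≈ S j) (sym (col-sum j)) (≈-sym (S≈σ j))) } ,
     λ i j → subst (λ k → fromℕ k ≈ fromℕ (entry i j)) (sym (symmetric j i)) ≈-refl) ,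
    λ i j → + entry i j , ≈-refl
    where open Symmetric𝒯ℕ A

  palindromic⇒symmetric : Palindromic R → Symmetric ρ
  palindromic⇒symmetric pal i = fromℕ-injective
    (≈-trans (≈-sym (R≈ρ (opposite i))) (≈-trans (≈-sym (pal i)) (R≈ρ i)))

  ∑ρ≡∑σ : sum R ≈ sum S → ∑ ρ ≡ ∑ σ
  ∑ρ≡∑σ ∑R≈∑S = fromℕ-injective (begin
    fromℕ (∑ ρ)         ≈⟨ fromℕ-homo-∑ ρ ⟩
    sum (fromℕ ∘ ρ)     ≈⟨ ∑ℝ.sum-cong-≋ R≈ρ ⟨
    sum R               ≈⟨ ∑R≈∑S ⟩
    sum S               ≈⟨ ∑ℝ.sum-cong-≋ S≈σ ⟩
    sum (fromℕ ∘ σ)     ≈⟨ fromℕ-homo-∑ σ ⟨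
    fromℕ (∑ σ)         ∎)

theorem10 : ∀ (m n : ℕ) .{{_ : NonZero m}} .{{_ : NonZero n}}
    (R : Vector ℝ m) (S : Vector ℝ n) →
    Nonneg R → Nonneg S → sum R ≈ sum S →
    (NonEmpty (𝒯⁰ R S) ⇔ Palindromic R)
    ×
    (∀ (ρ : Vector ℕ m) (σ : Vector ℕ n) →
    (∀ i → R i ≈ fromℕ (ρ i)) → (∀ j → S j ≈ fromℕ (σ j)) →
    NonEmpty (𝒯⁰ℤ R S) ⇔ (Palindromic R × ParityCondition ρ σ))
theorem10 m n R S 0≤R 0≤S ∑R≈∑S =
  mk⇔ 𝒯⁰⇒palindromic (palindromic⇒𝒯⁰ (𝒯-nonempty 0≤R 0≤S ∑R≈∑S)) ,
  λ ρ σ R≈ρ S≈σ → mk⇔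
    (λ where
      nonEmpty@(A , A∈𝒯⁰ , _) →
        𝒯⁰⇒palindromic (A , A∈𝒯⁰) ,
        parity-necessary (𝒯⁰ℤ⇒symmetric𝒯ℕ ρ σ R≈ρ S≈σ nonEmpty))
    (λ where
      (pal , parity) → symmetric𝒯ℕ⇒𝒯⁰ℤ ρ σ R≈ρ S≈σ (parity-sufficient
        (∑ρ≡∑σ ρ σ R≈ρ S≈σ ∑R≈∑S) (palindromic⇒symmetric ρ σ R≈ρ S≈σ pal) parity))
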